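{- Let $C=(1,c_2,c_3,c_4,c_5,c_6)$ be a canonical system whose subsystem $C'=(1,c_2,c_3,c_4,c_5)$ is noncanonical, and let $\ell=\lceil c_5/c_3\rceil$. Then $C$ satisfies (a), (b), or (c): (a) $C=(1,2,3,c_4,c_4+1,2c_4)$ and $c_4>4$; (b) $C=(1,c_2,2c_2-1,c_4,c_2+c_4-1,2c_4-1)$, $c_4\ge 3c_2-1$, $\mathrm{grd}_C(\ell c_3)=\ell c_3-c_5+1-\lfloor(\ell c_3-c_5)/c_2\rfloor(c_2-1)$, and $\mathrm{grd}_C(\ell c_3)\le\ell$; (c) $C=(1,c_2,2c_2,c_4,c_2+c_4,2c_4)$, $c_4\ge 3c_2-1$, $c_4\ne 3c_2$, $\mathrm{grd}_C(\ell c_3)=\ell c_3-c_5+1-\lfloor(\ell c_3-c_5)/c_2\rfloor(c_2-1)$, and $\mathrm{grd}_C(\ell c_3)\le\ell$.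
   Context: A system is a tuple $C=(c_1,\dots,c_n)$ of integers with $1=c_1<c_2<\dots<c_n$; for $k\le n$, $(c_1,\dots,c_k)$ is a subsystem. For a positive integer $v$, $\mathrm{opt}_C(v)$ is the minimum of $\sum_i x_i$ over $x\in\mathbb{Z}_{\ge0}^n$ with $\sum_i c_ix_i=v$. The greedy representation of $v$ is produced by: for $i=n$ down to $1$, while $c_i\le$ remaining value, take a coin $c_i$. $\mathrm{grd}_C(v)$ is its number of coins. A positive integer $w$ is a counterexample if $\mathrm{opt}_C(w)<\mathrm{grd}_C(w)$; $C$ is canonical if it has none, noncanonical otherwise. -}

module Defs where

open import Data.Nat using (ℕ; zero; suc; _+_; _*_; _∸_; _/_; _≤_; _<_; s≤s; z≤n)
open import Data.Nat.Properties
open import Data.List as List using (List; upTo; cartesianProductWith; filter)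
open import Data.List.Extrema.Nat using (min; min≤xs; argmin-sel)
open import Data.List.Membership.Propositional using (_∈_)
open import Data.List.Membership.Propositional.Properties using (∈-cartesianProductWith⁺; ∈-upTo⁺; ∈-filter⁺; ∈-filter⁻; ∈-map⁺; ∈-map⁻)
import Data.List.Relation.Unary.All as ListAll
open import Data.List.Relation.Unary.Any using (here)
open import Data.Vec using (Vec; []; _∷_; head; sum; zipWith; replicate)
open import Data.Vec.Relation.Unary.All using (All; []; _∷_)
open import Data.Vec.Relation.Unary.Linked using (Linked; [-]; _∷_)
open import Data.Product using (_×_; _,_; proj₁; proj₂; Σ-syntax)
open import Data.Sum using (inj₁; inj₂)
open import Function using (id)
open import Relation.Nullary using (¬_)
open import Relation.Binary.PropositionalEquality using (_≡_; refl; sym; trans; cong; cong₂; subst)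

private
  variable
    n : ℕ

-- Floor and ceiling of a quotient, totalised with the junk value 0 at
-- denominator 0.  Coins of a system are positive, so that value is never
-- relevant to a system.

⌊_/_⌋ : ℕ → ℕ → ℕ
⌊ m / zero ⌋    = 0
⌊ m / d@(suc _) ⌋ = m / d

⌈_/_⌉ : ℕ → ℕ → ℕ
⌈ m / zero ⌉    = 0
⌈ m / d@(suc e) ⌉ = (m + e) / d

record IsSystem (C : Vec ℕ (suc n)) : Set where
  field
    head≡1     : head C ≡ 1
    increasing : Linked _<_ C

value : Vec ℕ n → Vec ℕ n → ℕ
value C x = sum (zipWith _*_ C x)

box : (n b : ℕ) → List (Vec ℕ n)
box zero    b = List.[ [] ]
box (suc n) b = cartesianProductWith _∷_ (upTo (suc b)) (box n b)

-- For a system every representation x of v has all entries at most v, so the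
-- search space is exhaustive; the default v of the minimum is the size of the
-- representation by v coins 1.  See opt-attained and opt-minimal below.
opt : Vec ℕ n → ℕ → ℕ
opt {n} C v = min v (List.map sum (filter (λ x → value C x ≟ v) (box n v)))

-- Coin multiplicities chosen by the greedy algorithm, and the value left over.
-- Coins are listed in increasing order, so the tail is processed first; taking
-- the coin c while c ≤ r takes ⌊ r / c ⌋ copies of it.
greedy : Vec ℕ n → ℕ → Vec ℕ n × ℕ
greedy []       v = [] , v
greedy (c ∷ cs) v =
  let xs , r = greedy cs v
      x      = ⌊ r / c ⌋
  in x ∷ xs , r ∸ x * c

grd : Vec ℕ n → ℕ → ℕ
grd C v = sum (proj₁ (greedy C v))

Counterexample : Vec ℕ n → ℕ → Set
Counterexample C w = 0 < w × opt C w < grd C w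

Canonical : Vec ℕ n → Set
Canonical C = ∀ w → ¬ Counterexample C w

Noncanonical : Vec ℕ n → Set
Noncanonical C = ¬ Canonical C

private
  positive : {C : Vec ℕ (suc n)} → 0 < head C → Linked _<_ C → All (0 <_) C
  positive 0<c [-]        = 0<c ∷ []
  positive 0<c (c<d ∷ ds) = 0<c ∷ positive (<-trans 0<c c<d) ds

  ∈-box : ∀ {b} (C x : Vec ℕ n) → All (0 <_) C → value C x ≤ b → x ∈ box n b
  ∈-box []           []       []          _ = here refl
  ∈-box (suc c ∷ cs) (x ∷ xs) (_ ∷ cs>0) le =
    ∈-cartesianProductWith⁺ _∷_
      (∈-upTo⁺ (s≤s (≤-trans (m≤m+n x (c * x)) (≤-trans (m≤m+n _ _) le))))
      (∈-box cs xs cs>0 (≤-trans (m≤n+m _ _) le))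

  value-0 : (C : Vec ℕ n) → value C (replicate n 0) ≡ 0
  value-0 []       = refl
  value-0 (c ∷ cs) = cong₂ _+_ (*-zeroʳ c) (value-0 cs)

  sum-0 : ∀ n → sum (replicate n 0) ≡ 0
  sum-0 zero    = refl
  sum-0 (suc n) = sum-0 n

opt-attained : {C : Vec ℕ (suc n)} → IsSystem C → ∀ v →
               Σ[ x ∈ Vec ℕ (suc n) ] value C x ≡ v × sum x ≡ opt C v
opt-attained {n} {C = c ∷ cs} S v
  with argmin-sel id v (List.map sum (filter (λ x → value (c ∷ cs) x ≟ v) (box (suc n) v)))
... | inj₁ eq = v ∷ replicate n 0
    , trans (cong₂ _+_ (trans (cong (_* v) (IsSystem.head≡1 S)) (*-identityˡ v)) (value-0 cs)) (+-identityʳ v)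
    , trans (trans (cong (v +_) (sum-0 n)) (+-identityʳ v)) (sym eq)
... | inj₂ m∈ with x , x∈ , eq ← ∈-map⁻ sum m∈ =
  x , proj₂ (∈-filter⁻ (λ x → value (c ∷ cs) x ≟ v) {xs = box (suc n) v} x∈) , sym eq

opt-minimal : {C : Vec ℕ (suc n)} → IsSystem C → ∀ v x → value C x ≡ v → opt C v ≤ sum x
opt-minimal {n} {C} S v x eq =
  ListAll.lookup (min≤xs v _)
    (∈-map⁺ sum (∈-filter⁺ (λ y → value C y ≟ v)
      (∈-box C x (positive (subst (0 <_) (sym head≡1) (s≤s z≤n)) increasing) (≤-reflexive eq)) eq))
  where open IsSystem S

{-# OPTIONS --safe #-}
module Submission where

-- Write C = (1, a, b, p, q, r).  Where greedy is optimal, any payment can be replaced,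
-- without extra coins, by one that uses the greedy coin.  Hence C′ is canonical as soon
-- as every payment of an amount in [r, p + q) in coins of C′ can be changed to one with q.
-- As C′ is not canonical, r < p + q, so p + q = r + s and 2q = r + t for coins s < t.
-- If 2p < r, then 2p = q + u for a coin u; spending a greedy coin twice produces two
-- coins p, hence q, so C′ would be canonical.  Thus 2p = r + e with e = 0 or e a coin,
-- e + t = 2s and e < s, which leaves finitely many parametric families.  The families
-- other than (a), (b), (c) are excluded by the same exchange, using also p + b = q + u′,
-- or by a sum of two coins that greedy cannot pay with two coins.

open import Defs
open import Data.Nat using (ℕ; zero; suc; _+_; _*_; _∸_; _/_; _%_; _≤_; _<_; _≥_; _>_; z≤n; s≤s; s≤s⁻¹)
open import Data.Nat.Properties
open import Algebra.Properties.CommutativeSemigroup +-commutativeSemigroup using (x∙yz≈y∙xz; xy∙z≈y∙xz)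
open import Data.Nat.DivMod using (m≡m%n+[m/n]*n; m%n<n; m/n*n≤m; n/1≡n; m<n⇒m/n≡0; m/n≡1+[m∸n]/n)
open import Data.Nat.Induction using (<-rec)
open import Data.Nat.Tactic.RingSolver using (solve)
open import Data.List using ([]) renaming (_∷_ to infixr 5 _◂_)
open import Data.Vec using (Vec; []; _∷_; _∷ʳ_; _++_; head; sum)
open import Data.Vec.Membership.Propositional using (_∈_)
open import Data.Vec.Relation.Unary.All as All using (All; []; _∷_)
open import Data.Vec.Relation.Unary.Any using (here; there)
open import Data.Vec.Relation.Unary.Linked using (Linked; [-]; _∷_)
open import Data.Product using (_×_; _,_; proj₁; proj₂; ∃-syntax)
open import Data.Sum using (_⊎_; inj₁; inj₂; [_,_]′; map₂)
open import Data.Empty using (⊥; ⊥-elim)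
open import Relation.Nullary using (¬_; yes; no; contradiction)
open import Relation.Binary.PropositionalEquality using (_≡_; _≢_; refl; sym; trans; cong; cong₂; subst; subst₂)
open import Relation.Binary.PropositionalEquality using (module ≡-Reasoning)

private
  variable
    n c d j k t v w : ℕ
    C D : Vec ℕ n

-- Linear arithmetic: x ≤ y follows from a sum m ≤ n of hypotheses when
-- (y - x) - (n - m) is a polynomial s with natural coefficients.

infixr 5 _⊕_ _⊞_

_⊕_ : ∀ {m₁ n₁ m₂ n₂} → m₁ ≤ n₁ → m₂ ≤ n₂ → m₁ + m₂ ≤ n₁ + n₂
_⊕_ = +-mono-≤

_⊞_ : ∀ {m₁ n₁ m₂ n₂ : ℕ} → m₁ ≡ n₁ → m₂ ≡ n₂ → m₁ + m₂ ≡ n₁ + n₂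
_⊞_ = cong₂ _+_

≤-by : ∀ {x y m n} → m ≤ n → ∀ s → x + n + s ≡ y + m → x ≤ y
≤-by {x} {y} {m} {n} m≤n s eq = +-cancelʳ-≤ n x y (begin
  x + n      ≤⟨ m≤m+n (x + n) s ⟩
  x + n + s  ≡⟨ eq ⟩
  y + m      ≤⟨ +-monoʳ-≤ y m≤n ⟩
  y + n      ∎)
  where open ≤-Reasoning

≡-by : ∀ {x y m n} → m ≡ n → x + n ≡ y + m → x ≡ y
≡-by {x} {y} {m} {n} m≡n eq = +-cancelʳ-≡ n x y (trans eq (cong (y +_) m≡n))

⊥-by : ∀ {a} {A : Set a} {m n} → m ≤ n → ∀ s → n + suc s ≡ m → A
⊥-by {m = m} {n} m≤n s eq = contradiction m≤n (<⇒≱ (<-≤-trans (m<m+n n (s≤s z≤n)) (≤-reflexive eq)))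

-- Bounds on the rounded-up quotient

⌈/⌉-lower : ∀ m {n} → 0 < n → m ≤ ⌈ m / n ⌉ * n
-- For the divisor `suc n` the ceiling divides `m + n`; the remainder is at most `n`, which cancels
-- against the added `n`.
⌈/⌉-lower m {suc n} _ = +-cancelˡ-≤ n _ _ (begin
  n + m                                       ≡⟨ +-comm n m ⟩
  m + n                                       ≡⟨ m≡m%n+[m/n]*n (m + n) (suc n) ⟩
  (m + n) % suc n + (m + n) / suc n * suc n   ≤⟨ +-monoˡ-≤ _ (s≤s⁻¹ (m%n<n (m + n) (suc n))) ⟩
  n + (m + n) / suc n * suc n                 ∎)
  where open ≤-Reasoning

⌈/⌉-upper : ∀ m {n} → 0 < n → ⌈ m / n ⌉ * n < m + n
⌈/⌉-upper m {suc n} _ = ≤-<-trans (m/n*n≤m (m + n) (suc n)) (+-monoʳ-< m (n<1+n n))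

-- Payments

∈-below : ∀ {m n e d} (C : Vec ℕ m) {D : Vec ℕ n} → All (d ≤_) D → e ∈ C ++ D → e < d → e ∈ C
∈-below []      (d≤e ∷ _)  (here refl) e<d = contradiction d≤e (<⇒≱ e<d)
∈-below []      (_ ∷ d≤D)  (there e∈)  e<d = ∈-below [] d≤D e∈ e<d
∈-below (_ ∷ _) _          (here refl) _   = here refl
∈-below (_ ∷ C) d≤D        (there e∈)  e<d = there (∈-below C d≤D e∈ e<d)

-- The count is only an upper bound: done leaves any number of coins unspent.
data Change {n} (C : Vec ℕ n) : ℕ → ℕ → Set where
  done : Change C 0 k
  pay  : c ∈ C → Change C v k → Change C (c + v) (suc k)

-- A payment with the coin `c` brought to the front. The amount is tied to `c + v` by an equation,
-- so that a sum of coins may be regrouped without changing the index.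
data Spends {n} (C : Vec ℕ n) (c : ℕ) : ℕ → ℕ → Set where
  spend : w ≡ c + v → Change C v k → Spends C c w (suc k)

weaken : j ≤ k → Change C v j → Change C v k
weaken _         done       = done
weaken (s≤s j≤k) (pay c∈ x) = pay c∈ (weaken j≤k x)

-- A payment of `v` uses only coins up to `v`, so only these must lie in `D`. This removes `r` from
-- payments of amounts below `r`.
transfer : (∀ {c} → c ∈ C → c ≤ v → c ∈ D) → Change C v k → Change D v k
transfer ⊆ done               = done
transfer ⊆ (pay {c} {v} c∈ x) =
  pay (⊆ c∈ (m≤m+n c v)) (transfer (λ d∈ d≤ → ⊆ d∈ (≤-trans d≤ (m≤n+m v c))) x)

also-pay : c ∈ C → Spends C d v k → Spends C d (c + v) (suc k)
also-pay {c} {d = d} c∈ (spend {v = v} refl x) = spend (x∙yz≈y∙xz c d v) (pay c∈ x)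

-- The basic move: two coins are swapped for two others of the same sum, which keeps the count and
-- brings a desired coin `c′` to the front.
exchange : ∀ {c′ d′} → d′ ∈ C → c + d ≡ c′ + d′ → Spends C d v k → Spends C c′ (c + v) (suc k)
exchange {c = c} {d} {c′ = c′} {d′} d′∈ eq (spend {v = v} refl x) = spend regroup (pay d′∈ x)
  where
  regroup : c + (d + v) ≡ c′ + (d′ + v)
  regroup = trans (sym (+-assoc c d v)) (trans (cong (_+ v) eq) (+-assoc c′ d′ v))

pay-many : c ∈ C → ∀ i → Change C v k → Change C (i * c + v) (i + k)
pay-many c∈ zero x = x
pay-many {c} {C = C} {v} {k} c∈ (suc i) x =
  subst (λ z → Change C z (suc (i + k))) (sym (+-assoc c (i * c) v)) (pay c∈ (pay-many c∈ i x))

representation⇒change : (C x : Vec ℕ n) → Change C (value C x) (sum x)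
representation⇒change []       []       = done
representation⇒change (c ∷ cs) (x ∷ xs) =
  subst (λ z → Change (c ∷ cs) (z + value cs xs) (x + sum xs)) (*-comm x c)
    (pay-many (here refl) x (transfer (λ c∈ _ → there c∈) (representation⇒change cs xs)))

private
  add-coin : {C : Vec ℕ n} → c ∈ C → (x : Vec ℕ n) →
             ∃[ y ] value C y ≡ c + value C x × sum y ≡ suc (sum x)
  add-coin {C = c ∷ cs} (here refl) (x ∷ xs) =
    suc x ∷ xs , trans (cong (_+ value cs xs) (*-suc c x)) (+-assoc c (c * x) _) , refl
  add-coin {c = c} {C = d ∷ cs} (there c∈) (x ∷ xs) with add-coin c∈ xs
  ... | ys , veq , seq =
    x ∷ ys
    , trans (cong (d * x +_) veq) (x∙yz≈y∙xz (d * x) c (value cs xs))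
    , trans (cong (x +_) seq) (+-suc x _)

  empty : (C : Vec ℕ n) → ∃[ x ] value C x ≡ 0 × sum x ≡ 0
  empty []       = [] , refl , refl
  empty (c ∷ cs) with empty cs
  ... | xs , veq , seq = 0 ∷ xs , cong₂ _+_ (*-zeroʳ c) veq , seq

change⇒representation : Change C v k → ∃[ x ] value C x ≡ v × sum x ≤ k
change⇒representation {C = C} done with empty C
... | x , veq , seq = x , veq , subst (_≤ _) (sym seq) z≤n
change⇒representation (pay {c} c∈ p) with change⇒representation p
... | x , veq , s≤ with add-coin c∈ x
... | y , veq′ , seq = y , trans veq′ (cong (c +_) veq) , subst (_≤ _) (sym seq) (s≤s s≤)

-- The greedy algorithm

-- The coin that greedy takes first for `v`: greedy starts at the end of the list and skips every
-- coin exceeding `v`.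
data Top : Vec ℕ n → ℕ → ℕ → Set where
  here  : c ≤ v → All (v <_) C → Top (c ∷ C) v c
  there : Top C v c → Top (d ∷ C) v c

top-≤ : Top C v c → c ≤ v
top-≤ (here c≤v _) = c≤v
top-≤ (there t)    = top-≤ t

rest : Vec ℕ n → ℕ → ℕ
rest C v = proj₂ (greedy C v)

greedy-below : All (v <_) C → grd C v ≡ 0 × rest C v ≡ v
greedy-below [] = refl , refl
greedy-below {v} {C = suc c ∷ cs} (v<c ∷ v<cs) with greedy-below v<cs
... | geq , req rewrite req | m<n⇒m/n≡0 v<c = geq , refl

<-below : w ≤ v → All (v <_) C → All (w <_) C
<-below w≤v = All.map (≤-<-trans w≤v)

-- Adding `c` to the amount raises the quotient by `c` by one and keeps its remainder. Earlier coins
-- in the list see only that remainder, hence the induction carries both equations.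
greedy-top : 0 < c → Top C (c + v) c → grd C (c + v) ≡ suc (grd C v) × rest C (c + v) ≡ rest C v
greedy-top {suc c} {v = v} _ (here _ below)
  with greedy-below below | greedy-below (<-below (m≤n+m v (suc c)) below)
... | geq , req | geq′ , req′
  rewrite req | req′ | geq | geq′
        | m/n≡1+[m∸n]/n {suc c + v} {suc c} (m≤m+n (suc c) v) | m+n∸m≡n (suc c) v
  = refl , [m+n]∸[m+o]≡n∸o (suc c) v _
greedy-top {c} {v = v} 0<c (there {d = d} t) with greedy-top 0<c t
... | geq , req rewrite req | geq = +-suc ⌊ _ / d ⌋ _ , refl

-- A last coin above `v` is taken zero times. With `r` as that coin, the five-coin and six-coin
-- systems have the same greedy cost below `r`.
greedy-∷ʳ : (C : Vec ℕ n) → v < d → grd (C ∷ʳ d) v ≡ grd C v × rest (C ∷ʳ d) v ≡ rest C v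
greedy-∷ʳ []       v<d = greedy-below (v<d ∷ [])
greedy-∷ʳ (c ∷ cs) v<d with greedy-∷ʳ cs v<d
... | geq , req rewrite req | geq = refl , refl

-- Greedy pays with units and copies of `c`, and each copy of `c` replaces `c` units, saving `c ∸ 1`
-- coins. The additive form avoids truncated subtraction.
grd-two : ∀ {cs : Vec ℕ n} → 0 < c → All (v <_) cs → grd (1 ∷ c ∷ cs) v + ⌊ v / c ⌋ * (c ∸ 1) ≡ v
grd-two {c = suc c} {v} _ v<cs with greedy-below v<cs
... | geq , req rewrite req | geq | n/1≡n (v ∸ v / suc c * suc c) = begin
  v ∸ x * suc c + (x + 0) + x * c  ≡⟨ regroup (v ∸ x * suc c) x ⟩
  v ∸ x * suc c + x * suc c        ≡⟨ m∸n+n≡m (m/n*n≤m v (suc c)) ⟩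
  v                                ∎
  where
  open ≡-Reasoning
  x = v / suc c
  regroup : ∀ y x → y + (x + 0) + x * c ≡ y + x * suc c
  regroup y x = solve (y ◂ x ◂ c ◂ [])

greedy-value : (C : Vec ℕ n) → ∀ v → value C (proj₁ (greedy C v)) + rest C v ≡ v
greedy-value []               v = refl
-- The junk value of division by 0 makes greedy take no coin 0.
greedy-value (zero ∷ cs)      v = greedy-value cs v
greedy-value (c@(suc _) ∷ cs) v = begin
  c * (r / c) + value cs xs + (r ∸ r / c * c)  ≡⟨ cong (λ z → z + value cs xs + y) (*-comm c (r / c)) ⟩
  r / c * c + value cs xs + (r ∸ r / c * c)    ≡⟨ xy∙z≈y∙xz (r / c * c) (value cs xs) _ ⟩
  value cs xs + (r / c * c + (r ∸ r / c * c))  ≡⟨ cong (value cs xs +_) (m+[n∸m]≡n (m/n*n≤m r c)) ⟩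
  value cs xs + r                              ≡⟨ greedy-value cs v ⟩
  v                                            ∎
  where
  open ≡-Reasoning
  xs = proj₁ (greedy cs v)
  r  = rest cs v
  y  = r ∸ r / c * c

-- The coin 1 comes last in the greedy order and clears whatever is left.
greedy-change : (cs : Vec ℕ n) → ∀ v → Change (1 ∷ cs) v (grd (1 ∷ cs) v)
greedy-change cs v = subst (λ z → Change coins z (grd coins v)) paid (representation⇒change coins xs)
  where
  coins = 1 ∷ cs
  xs    = proj₁ (greedy coins v)
  r     = rest cs v

  rest≡0 : rest coins v ≡ 0
  rest≡0 = trans (cong (r ∸_) (trans (*-identityʳ _) (n/1≡n r))) (n∸n≡0 r)

  paid : value coins xs ≡ v
  paid = begin
    value coins xs                 ≡⟨ +-identityʳ _ ⟨
    value coins xs + 0             ≡⟨ cong (value coins xs +_) rest≡0 ⟨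
    value coins xs + rest coins v  ≡⟨ greedy-value coins v ⟩
    v                              ∎
    where open ≡-Reasoning

-- Canonicity

-- Optimality at a single amount, so that it can be proved by strong induction; quantifying over
-- payments with a bound on the count avoids computing `opt`.
OptimalAt : Vec ℕ n → ℕ → Set
OptimalAt C v = ∀ {k} → Change C v k → grd C v ≤ k

linked⇒positive : {C : Vec ℕ (suc n)} → 0 < head C → Linked _<_ C → All (0 <_) C
linked⇒positive 0<c [-]         = 0<c ∷ []
linked⇒positive 0<c (c<d ∷ lnk) = 0<c ∷ linked⇒positive (<-trans 0<c c<d) lnk

canonical⇒optimal : {C : Vec ℕ (suc n)} → IsSystem C → Canonical C → ∀ v → OptimalAt C v
-- A counterexample is positive, so canonicity is silent at 0; there greedy takes no coin.
canonical⇒optimal {C = C} S K zero    _ = subst (_≤ _) (sym (proj₁ (greedy-below all>0))) z≤n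
  where all>0 = linked⇒positive (subst (0 <_) (sym (IsSystem.head≡1 S)) (s≤s z≤n)) (IsSystem.increasing S)
canonical⇒optimal S K (suc v) x with change⇒representation x
... | y , veq , s≤ = ≤-trans (≮⇒≥ λ lt → K (suc v) (s≤s z≤n , lt)) (≤-trans (opt-minimal S (suc v) y veq) s≤)

optimal⇒canonical : {C : Vec ℕ (suc n)} → IsSystem C → (∀ v → OptimalAt C v) → Canonical C
optimal⇒canonical {C = C} S optimal w (_ , lt) with opt-attained S w
... | x , refl , seq = <⇒≱ lt (subst (grd C w ≤_) seq (optimal w (representation⇒change C x)))

-- The new payment is the greedy one: it starts with `c`, and optimality bounds its count by `k`.
spend-top : {cs : Vec ℕ n} → 0 < c → Top (1 ∷ cs) v c → OptimalAt (1 ∷ cs) v →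
            Change (1 ∷ cs) v k → Spends (1 ∷ cs) c v k
spend-top {c = c} {v} {k} {cs = cs} 0<c t optimal x with m≤n⇒∃[o]m+o≡n (top-≤ t)
... | v′ , refl with subst (_≤ k) (proj₁ (greedy-top 0<c t)) (optimal x)
... | s≤s le = spend refl (weaken le (greedy-change cs v′))

-- The converse of `spend-top`, used as an induction step: once the greedy coin is spent, greedy is
-- already optimal for the smaller remainder.
spends-top⇒grd≤ : 0 < c → Top C v c → (∀ {u} → u < v → OptimalAt C u) → Spends C c v k → grd C v ≤ k
spends-top⇒grd≤ {c} {k = suc k} 0<c t optimal (spend {v = v} refl x) =
  subst (_≤ suc k) (sym (proj₁ (greedy-top 0<c t))) (s≤s (optimal (m<n+m v 0<c) x))

-- Systems of six coins

module SixCoins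
  {a b p q r : ℕ} (1<a : 1 < a) (a<b : a < b) (b<p : b < p) (p<q : p < q) (q<r : q < r)
  (optimal : ∀ v → OptimalAt (1 ∷ a ∷ b ∷ p ∷ q ∷ r ∷ []) v)
  where

  C₅ : Vec ℕ 5
  C₅ = 1 ∷ a ∷ b ∷ p ∷ q ∷ []

  C₆ : Vec ℕ 6
  C₆ = 1 ∷ a ∷ b ∷ p ∷ q ∷ r ∷ []

  pattern 1∈ = here refl
  pattern a∈ = there (here refl)
  pattern b∈ = there (there (here refl))
  pattern p∈ = there (there (there (here refl)))
  pattern q∈ = there (there (there (there (here refl))))
  pattern r∈ = there (there (there (there (there (here refl)))))

  system₅ : IsSystem C₅
  system₅ = record { head≡1 = refl ; increasing = 1<a ∷ a<b ∷ b<p ∷ p<q ∷ [-] }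

  0<a : 0 < a
  0<a = <-trans (s≤s z≤n) 1<a

  0<b : 0 < b
  0<b = <-trans 0<a a<b

  0<p : 0 < p
  0<p = <-trans 0<b b<p

  0<q : 0 < q
  0<q = <-trans 0<p p<q

  0<r : 0 < r
  0<r = <-trans 0<q q<r

  top-a : a ≤ v → v < b → Top C₆ v a
  top-a a≤v v<b = there (here a≤v (v<b ∷ v<p ∷ v<q ∷ <-trans v<q q<r ∷ []))
    where
    v<p = <-trans v<b b<p
    v<q = <-trans v<p p<q

  top-b : b ≤ v → v < p → Top C₆ v b
  top-b b≤v v<p = there (there (here b≤v (v<p ∷ v<q ∷ <-trans v<q q<r ∷ [])))
    where v<q = <-trans v<p p<q

  top-p : p ≤ v → v < q → Top C₆ v p
  top-p p≤v v<q = there (there (there (here p≤v (v<q ∷ <-trans v<q q<r ∷ []))))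

  top-q : q ≤ v → v < r → Top C₆ v q
  top-q q≤v v<r = there (there (there (there (here q≤v (v<r ∷ [])))))

  top-r : r ≤ v → Top C₆ v r
  top-r r≤v = there (there (there (there (there (here r≤v [])))))

  extend : Change C₅ v k → Change C₆ v k
  extend = transfer λ { 1∈ _ → 1∈ ; a∈ _ → a∈ ; b∈ _ → b∈ ; p∈ _ → p∈ ; q∈ _ → q∈ }

  restrict : v < r → Change C₆ v k → Change C₅ v k
  restrict v<r = transfer λ { 1∈ _ → 1∈ ; a∈ _ → a∈ ; b∈ _ → b∈ ; p∈ _ → p∈ ; q∈ _ → q∈
                            ; r∈ r≤v → contradiction r≤v (<⇒≱ v<r) }

  -- Below `r` the coin `r` cannot occur, so the optimality of `C₆` acts on payments in `C₅`.
  spend-top₅ : 0 < c → v < r → Top C₆ v c → Change C₅ v k → Spends C₅ c v k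
  spend-top₅ {c} {v} 0<c v<r t x with spend-top 0<c t (optimal v) (extend x)
  ... | spend {v = v′} refl y = spend refl (restrict (≤-<-trans (m≤n+m v′ c) v<r) y)

  optimal₅-below : v < r → OptimalAt C₅ v
  optimal₅-below {v} v<r {k} x = subst (_≤ k) (proj₁ (greedy-∷ʳ C₅ v<r)) (optimal v (extend x))

  -- Exchange criteria for the five-coin system to be canonical

  below-q : c ∈ C₅ → c ≤ p ⊎ c ≡ q
  below-q 1∈ = inj₁ 0<p
  below-q a∈ = inj₁ (<⇒≤ (<-trans a<b b<p))
  below-q b∈ = inj₁ (<⇒≤ b<p)
  below-q p∈ = inj₁ ≤-refl
  below-q q∈ = inj₂ refl

  positive : c ∈ C₅ → 0 < c
  positive 1∈ = s≤s z≤n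
  positive a∈ = 0<a
  positive b∈ = 0<b
  positive p∈ = 0<p
  positive q∈ = 0<q

  -- Beyond p + q a payment without q still leaves at least q after its first coin,
  -- so by induction it can be changed to one with q.
  q-spendable⇒canonical : (∀ {w k} → r ≤ w → w < p + q → Change C₅ w k → Spends C₅ q w k) → Canonical C₅
  q-spendable⇒canonical spendable = optimal⇒canonical system₅ (<-rec (OptimalAt C₅) step)
    where
    top₅ : q ≤ v → Top C₅ v q
    top₅ q≤v = there (there (there (there (here q≤v []))))

    far : (∀ {u} → u < v → OptimalAt C₅ u) → p + q ≤ v → Change C₅ v k → Spends C₅ q v k
    far _ p+q≤v done = contradiction p+q≤v (<⇒≱ (<-≤-trans 0<p (m≤m+n p q)))
    far ih p+q≤v (pay {c} {v} c∈ x) with below-q c∈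
    ... | inj₂ refl = spend refl x
    ... | inj₁ c≤p  = also-pay c∈ (spend-top 0<q (top₅ q≤v) (ih (m<n+m v (positive c∈))) x)
      where
      q≤v : q ≤ v
      q≤v = ≤-by (c≤p ⊕ p+q≤v) 0 (solve (c ◂ p ◂ q ◂ v ◂ []))

    step : ∀ v → (∀ {u} → u < v → OptimalAt C₅ u) → OptimalAt C₅ v
    step v ih x with v <? r | v <? p + q
    ... | yes v<r | _ = optimal₅-below v<r x
    ... | no v≮r | yes v<p+q =
      spends-top⇒grd≤ 0<q (top₅ (≤-trans (<⇒≤ q<r) (≮⇒≥ v≮r))) ih (spendable (≮⇒≥ v≮r) v<p+q x)
    ... | no v≮r | no v≮p+q =
      spends-top⇒grd≤ 0<q (top₅ (≤-trans (<⇒≤ q<r) (≮⇒≥ v≮r))) ih (far ih (≮⇒≥ v≮p+q) x)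

  -- Coins are peeled off until the amount `v` left is below `r`. If `v` is at least `q`, its greedy
  -- coin is `q`. So only a first coin that leads from below `q` to at least `r` calls for an
  -- exchange.
  q-exchange⇒canonical :
    (∀ {c v k} → c ∈ C₅ → c ≤ p → v < q → r ≤ c + v → Change C₅ v k → Spends C₅ q (c + v) (suc k)) →
    Canonical C₅
  q-exchange⇒canonical exch = q-spendable⇒canonical λ r≤w _ → peel r≤w
    where
    peel : r ≤ w → Change C₅ w k → Spends C₅ q w k
    peel r≤w done = contradiction r≤w (<⇒≱ 0<r)
    peel r≤w (pay {c} {v} c∈ x) with below-q c∈ | v <? q | v <? r
    ... | inj₂ refl | _       | _       = spend refl x
    ... | inj₁ c≤p  | yes v<q | _       = exch c∈ c≤p v<q r≤w x
    ... | inj₁ _    | no v≮q  | yes v<r = also-pay c∈ (spend-top₅ 0<q v<r (top-q (≮⇒≥ v≮q) v<r) x)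
    ... | inj₁ _    | no _    | no v≮r  = also-pay c∈ (peel (≮⇒≥ v≮r) x)

  -- From `2p ≤ r ≤ c + v` and `c ≤ p` follows `p ≤ v < q`, so `p` can be spent from `v`. What then
  -- remains of `c + v` again lies between `p` and `q` and yields a second `p`; the two become `q`
  -- and `u`.
  exchange-pp⇒canonical : ∀ {u} → u ∈ C₅ → p + p ≡ q + u → p + p ≤ r → Canonical C₅
  exchange-pp⇒canonical {u} u∈ 2p≡q+u 2p≤r = q-exchange⇒canonical exch
    where
    exch : c ∈ C₅ → c ≤ p → v < q → r ≤ c + v → Change C₅ v k → Spends C₅ q (c + v) (suc k)
    exch {c} {v} c∈ c≤p v<q r≤c+v x = again (also-pay c∈ (spend-top₅ 0<p (<-trans v<q q<r) (top-p p≤v v<q) x))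
      where
      p≤v : p ≤ v
      p≤v = ≤-by (2p≤r ⊕ r≤c+v ⊕ c≤p) 0 (solve (c ◂ p ◂ r ◂ v ◂ []))

      again : Spends C₅ p (c + v) k → Spends C₅ q (c + v) k
      again {suc k} (spend {v = w} eq y) =
        subst (λ z → Spends C₅ q z (suc k)) (sym eq)
          (exchange u∈ 2p≡q+u (spend-top₅ 0<p (<-trans w<q q<r) (top-p p≤w w<q) y))
        where
        p≤w : p ≤ w
        p≤w = ≤-by (≤-reflexive eq ⊕ r≤c+v ⊕ 2p≤r) 0 (solve (c ◂ p ◂ r ◂ v ◂ w ◂ []))
        w<q : w < q
        w<q = ≤-by (≤-reflexive (sym eq) ⊕ c≤p ⊕ v<q) 0 (solve (c ◂ p ◂ q ◂ v ◂ w ◂ []))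

  -- For amounts from `m` on, the first coin cannot be 1 or `a`, since `q + a ≤ m`. A first coin `b`
  -- leaves at least `p`, and a first coin `p` leaves at least `b`, so a pair `b, p` or `p, p`
  -- appears and is exchanged. Amounts in `[r, m)` are left to `small`, which is vacuous for
  -- `m = r`.
  exchange-pb⇒canonical : ∀ {u t m} → u ∈ C₅ → p + p ≡ q + u → t ∈ C₅ → p + b ≡ q + t →
    p + b ≤ m → q + a ≤ m →
    (∀ {c v k} → c ∈ C₅ → c ≤ p → v < q → r ≤ c + v → c + v < m →
      Change C₅ v k → Spends C₅ q (c + v) (suc k)) →
    Canonical C₅
  exchange-pb⇒canonical {u} {t} {m} u∈ 2p≡q+u t∈ p+b≡q+t p+b≤m q+a≤m small = q-exchange⇒canonical exch
    where
    large : c ∈ C₅ → c ≤ p → v < q → m ≤ c + v → Change C₅ v k → Spends C₅ q (c + v) (suc k)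
    large {v = v} 1∈ _ v<q m≤1+v x = ⊥-by (m≤1+v ⊕ q+a≤m ⊕ 1<a ⊕ v<q) 1 (solve (a ◂ m ◂ q ◂ v ◂ []))
    large {v = v} a∈ _ v<q m≤a+v x = ⊥-by (m≤a+v ⊕ q+a≤m ⊕ v<q) 0 (solve (a ◂ m ◂ q ◂ v ◂ []))
    large {v = v} b∈ _ v<q m≤b+v x =
      exchange t∈ (trans (+-comm b p) p+b≡q+t) (spend-top₅ 0<p (<-trans v<q q<r) (top-p p≤v v<q) x)
      where
      p≤v : p ≤ v
      p≤v = ≤-by (m≤b+v ⊕ p+b≤m) 0 (solve (b ◂ m ◂ p ◂ v ◂ []))
    large {v = v} p∈ _ v<q m≤p+v x with v <? p
    ... | yes v<p = exchange t∈ p+b≡q+t (spend-top₅ 0<b (<-trans v<q q<r) (top-b b≤v v<p) x)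
      where
      b≤v : b ≤ v
      b≤v = ≤-by (m≤p+v ⊕ p+b≤m) 0 (solve (b ◂ m ◂ p ◂ v ◂ []))
    ... | no v≮p = exchange u∈ 2p≡q+u (spend-top₅ 0<p (<-trans v<q q<r) (top-p (≮⇒≥ v≮p) v<q) x)
    large q∈ q≤p = contradiction q≤p (<⇒≱ p<q)

    exch : c ∈ C₅ → c ≤ p → v < q → r ≤ c + v → Change C₅ v k → Spends C₅ q (c + v) (suc k)
    exch {c} {v} c∈ c≤p v<q r≤c+v x with c + v <? m
    ... | yes c+v<m = small c∈ c≤p v<q r≤c+v c+v<m x
    ... | no c+v≮m  = large c∈ c≤p v<q (≮⇒≥ c+v≮m) x

  -- Sums of two coins, and coins below a bound

  change-one : ∀ e → Change C₆ e 1 → e ≡ 0 ⊎ e ∈ C₆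
  change-one .0       done              = inj₁ refl
  change-one .(c + 0) (pay {c} c∈ done) = inj₂ (subst (_∈ C₆) (sym (+-identityʳ c)) c∈)

  -- Greedy pays `c + d` with at most two coins, the first being `t`; so at most one coin is left.
  -- This is how canonicity of `C₆` produces equations between coins.
  two-coins : c ∈ C₆ → d ∈ C₆ → 0 < t → Top C₆ (c + d) t → ∃[ e ] t + e ≡ c + d × (e ≡ 0 ⊎ e ∈ C₆)
  two-coins {c} {d} c∈ d∈ 0<t top
    with spend-top 0<t top (optimal (c + d)) (pay c∈ one-d)
    where
    one-d : Change C₆ d 1
    one-d = subst (λ z → Change C₆ z 1) (+-identityʳ d) (pay d∈ done)
  ... | spend {v = e} eq x = e , sym eq , change-one e x

  below-a : ∀ {e} → e ∈ C₆ → e < a → e ≡ 1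
  below-a e∈ e<a with ∈-below (1 ∷ []) a≤coins e∈ e<a
    where
    a<p : a < p
    a<p = <-trans a<b b<p
    a<q : a < q
    a<q = <-trans a<p p<q
    a≤coins : All (a ≤_) (a ∷ b ∷ p ∷ q ∷ r ∷ [])
    a≤coins = ≤-refl ∷ <⇒≤ a<b ∷ <⇒≤ a<p ∷ <⇒≤ a<q ∷ <⇒≤ (<-trans a<q q<r) ∷ []
  ... | 1∈ = refl

  below-b : ∀ {e} → e ∈ C₆ → e < b → e ∈ (1 ∷ a ∷ [])
  below-b = ∈-below (1 ∷ a ∷ []) (≤-refl ∷ <⇒≤ b<p ∷ <⇒≤ b<q ∷ <⇒≤ (<-trans b<q q<r) ∷ [])
    where b<q = <-trans b<p p<q

  below-p : ∀ {e} → e ∈ C₆ → e < p → e ∈ (1 ∷ a ∷ b ∷ [])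
  below-p = ∈-below (1 ∷ a ∷ b ∷ []) (≤-refl ∷ <⇒≤ p<q ∷ <⇒≤ (<-trans p<q q<r) ∷ [])

  below-q₆ : ∀ {e} → e ∈ C₆ → e < q → e ∈ (1 ∷ a ∷ b ∷ p ∷ [])
  below-q₆ = ∈-below (1 ∷ a ∷ b ∷ p ∷ []) (≤-refl ∷ <⇒≤ q<r ∷ [])

  -- The conditions on the coins in (a), (b) and (c), cleared of subtractions; the claims on greedy
  -- costs are derived from them afterwards.
  Shape-a Shape-b Shape-c : Set
  Shape-a = a ≡ 2 × b ≡ 3 × q ≡ p + 1 × r ≡ p + p × 4 < p
  Shape-b = b + 1 ≡ a + a × q + 1 ≡ a + p × r + 1 ≡ p + p × a + a + a ≤ p + 1
  Shape-c = b ≡ a + a × q ≡ a + p × r ≡ p + p × a + a + a ≤ p + 1 × p ≢ a + a + a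

  -- Case analysis on the sums `p + q`, `2q` and `2p`

  module Overlap
    (noncanonical : Noncanonical C₅) {s t : ℕ}
    (r<p+q : r < p + q)
    (r+s : r + s ≡ p + q) (s-coin : s ≡ 0 ⊎ s ∈ C₆) (r+t : r + t ≡ q + q) (t-coin : t ≡ 0 ⊎ t ∈ C₆)
    where

    s∈ : s ∈ (1 ∷ a ∷ b ∷ [])
    s∈ = [ (λ s≡0 → contradiction s≡0 s≢0) , (λ s∈₆ → below-p s∈₆ s<p) ]′ s-coin
      where
      s≢0 : s ≢ 0
      s≢0 s≡0 = ⊥-by (≤-reflexive s≡0 ⊕ ≤-reflexive (sym r+s) ⊕ r<p+q) 0 (solve (p ◂ q ◂ r ◂ s ◂ []))
      s<p : s < p
      s<p = ≤-by (≤-reflexive r+s ⊕ q<r) 0 (solve (p ◂ q ◂ r ◂ s ◂ []))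

    t∈ : t ∈ (1 ∷ a ∷ b ∷ p ∷ [])
    t∈ = [ (λ t≡0 → contradiction t≡0 t≢0) , (λ t∈₆ → below-q₆ t∈₆ t<q) ]′ t-coin
      where
      t≢0 : t ≢ 0
      t≢0 t≡0 = ⊥-by (≤-reflexive t≡0 ⊕ ≤-reflexive (sym r+t) ⊕ r<p+q ⊕ p<q) 1 (solve (p ◂ q ◂ r ◂ t ◂ []))
      t<q : t < q
      t<q = ≤-by (≤-reflexive r+t ⊕ q<r) 0 (solve (q ◂ r ◂ t ◂ []))

    s<t : s < t
    s<t = ≤-by (≤-reflexive r+s ⊕ ≤-reflexive (sym r+t) ⊕ p<q) 0 (solve (p ◂ q ◂ r ◂ s ◂ t ◂ []))

    0<s : 0 < s
    0<s = ≤-by (≤-reflexive (sym r+s) ⊕ r<p+q) 0 (solve (p ◂ q ◂ r ◂ s ◂ []))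

    t≤p : t ≤ p
    t≤p with t∈
    ... | 1∈ = 0<p
    ... | a∈ = <⇒≤ (<-trans a<b b<p)
    ... | b∈ = <⇒≤ b<p
    ... | p∈ = ≤-refl

    -- Comparing the two sums gives `q + s = p + t`, where `t ≤ p` and `s` is positive.
    q<2p : q < p + p
    q<2p =
      ≤-by (≤-reflexive r+s ⊕ ≤-reflexive (sym r+t) ⊕ 0<s ⊕ t≤p) 0 (solve (p ◂ q ◂ r ◂ s ◂ t ◂ []))

    -- Otherwise `q` is the greedy coin of `2p`, so `2p = q + u` for a coin `u` below `p`, and
    -- `exchange-pp⇒canonical` applies.
    r≤2p : r ≤ p + p
    r≤2p with p + p <? r
    ... | no 2p≮r = ≮⇒≥ 2p≮r
    ... | yes 2p<r with two-coins p∈ p∈ 0<q (top-q (<⇒≤ q<2p) 2p<r)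
    ... | u , q+u , inj₁ refl = ⊥-by (≤-reflexive (sym q+u) ⊕ q<2p) 0 (solve (p ◂ q ◂ []))
    ... | u , q+u , inj₂ u∈   =
      contradiction (exchange-pp⇒canonical (lower (below-p u∈ u<p)) (sym q+u) (<⇒≤ 2p<r)) noncanonical
      where
      u<p : u < p
      u<p = ≤-by (≤-reflexive q+u ⊕ p<q) 0 (solve (p ◂ q ◂ u ◂ []))
      lower : c ∈ (1 ∷ a ∷ b ∷ []) → c ∈ C₅
      lower 1∈ = 1∈
      lower a∈ = a∈
      lower b∈ = b∈

    module Excess {e : ℕ} (r+e : r + e ≡ p + p) (e-coin : e ≡ 0 ⊎ e ∈ C₆) where

      -- Both `2p + 2q` and twice `p + q` are written with `r` and compared.
      e+t : e + t ≡ s + s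
      e+t = ≡-by (sym r+s ⊞ sym r+s ⊞ r+t ⊞ r+e) (solve (e ◂ p ◂ q ◂ r ◂ s ◂ t ◂ []))

      e<s : e < s
      e<s = ≤-by (≤-reflexive (sym r+s) ⊕ ≤-reflexive r+e ⊕ p<q) 0 (solve (e ◂ p ◂ q ◂ r ◂ s ◂ []))

      case-1 : s ≡ 1 → Shape-a
      case-1 s≡1 = a≡2 , b≡3 , q≡p+1 , r≡2p , ≰⇒> p≰4
        where
        e≡0 : e ≡ 0
        e≡0 = n<1⇒n≡0 (subst (e <_) s≡1 e<s)

        2<p : 2 < p
        2<p = ≤-<-trans 1<a (<-trans a<b b<p)

        a≡2 : a ≡ 2
        -- Here `e = 0`, so `t = 2`, which as a coin can only be `a`.
        a≡2 with t∈
        ... | here t≡1 =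
          ⊥-by (≤-reflexive t≡1 ⊕ ≤-reflexive (sym s≡1) ⊕ s<t) 0 (solve (s ◂ t ◂ []))
        ... | there (here t≡a) =
          ≡-by (sym t≡a ⊞ e+t ⊞ sym e≡0 ⊞ s≡1 ⊞ s≡1) (solve (a ◂ e ◂ s ◂ t ◂ []))
        ... | there (there (here t≡b)) =
          ⊥-by (≤-reflexive (sym t≡b) ⊕ ≤-reflexive e+t ⊕ ≤-reflexive s≡1 ⊕ ≤-reflexive s≡1 ⊕ a<b ⊕ 1<a) e
            (solve (a ◂ b ◂ e ◂ s ◂ t ◂ []))
        ... | there (there (there (here t≡p))) =
          ⊥-by (≤-reflexive (sym t≡p) ⊕ ≤-reflexive e+t ⊕ ≤-reflexive s≡1 ⊕ ≤-reflexive s≡1 ⊕ 2<p) e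
            (solve (e ◂ p ◂ s ◂ t ◂ []))

        r≡2p : r ≡ p + p
        r≡2p = ≡-by (r+e ⊞ sym e≡0) (solve (e ◂ p ◂ r ◂ []))

        q≡p+1 : q ≡ p + 1
        q≡p+1 = ≡-by (sym r+s ⊞ r≡2p ⊞ s≡1) (solve (p ◂ q ◂ r ◂ s ◂ []))

        b≡3 : b ≡ 3
        -- The greedy coin of `p + b` is `q = p + 1`, so `b - 1` is a coin below `b`; it exceeds 1,
        -- hence equals `a = 2`.
        b≡3 with two-coins p∈ b∈ 0<q (top-q q≤p+b p+b<r)
          where
          q≤p+b : q ≤ p + b
          q≤p+b = ≤-by (≤-reflexive q≡p+1 ⊕ a<b) a (solve (a ◂ b ◂ p ◂ q ◂ []))
          p+b<r : p + b < r
          p+b<r = ≤-by (b<p ⊕ ≤-reflexive (sym r≡2p)) 0 (solve (b ◂ p ◂ r ◂ []))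
        ... | z , q+z , inj₁ z≡0 =
          ⊥-by (≤-reflexive z≡0 ⊕ ≤-reflexive (sym q+z) ⊕ ≤-reflexive q≡p+1 ⊕ a<b ⊕ 1<a) 1
            (solve (a ◂ b ◂ p ◂ q ◂ z ◂ []))
        ... | z , q+z , inj₂ z∈ with below-b z∈ (≤-by (≤-reflexive q+z ⊕ p<q) 0 (solve (b ◂ p ◂ q ◂ z ◂ [])))
        ... | here z≡1 =
          ⊥-by (≤-reflexive z≡1 ⊕ ≤-reflexive (sym q+z) ⊕ ≤-reflexive q≡p+1 ⊕ a<b ⊕ 1<a) 0
            (solve (a ◂ b ◂ p ◂ q ◂ z ◂ []))
        ... | there (here z≡a) = ≡-by (z≡a ⊞ sym q+z ⊞ q≡p+1 ⊞ a≡2) (solve (a ◂ b ◂ p ◂ q ◂ z ◂ []))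

        p≰4 : ¬ p ≤ 4
        -- As `b = 3 < p`, this would force `p = 4`, `q = 5` and `2p = 8 = q + b`.
        p≰4 p≤4 = noncanonical (exchange-pp⇒canonical b∈ 2p≡q+b (≤-reflexive (sym r≡2p)))
          where
          2p≡q+b : p + p ≡ q + b
          2p≡q+b =
            ≤-antisym (≤-by (≤-reflexive (sym q≡p+1) ⊕ ≤-reflexive (sym b≡3) ⊕ p≤4) 0 (solve (b ◂ p ◂ q ◂ [])))
                      (≤-by (≤-reflexive q≡p+1 ⊕ b<p) 0 (solve (b ◂ p ◂ q ◂ [])))

      case-a-0 : s ≡ a → t ≡ b → e ≡ 0 → Shape-c
      case-a-0 s≡a t≡b e≡0 = b≡2a , q≡a+p , r≡2p , ≮⇒≥ p+1≮3a , p≢3a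
        where
        b≡2a : b ≡ a + a
        b≡2a = ≡-by (e+t ⊞ s≡a ⊞ s≡a ⊞ sym t≡b ⊞ sym e≡0) (solve (a ◂ b ◂ e ◂ s ◂ t ◂ []))

        r≡2p : r ≡ p + p
        r≡2p = ≡-by (r+e ⊞ sym e≡0) (solve (e ◂ p ◂ r ◂ []))

        q≡a+p : q ≡ a + p
        q≡a+p = ≡-by (sym r+s ⊞ r≡2p ⊞ s≡a) (solve (a ◂ p ◂ q ◂ r ◂ s ◂ []))

        p+1≮3a : ¬ p + 1 < a + a + a
        -- After its greedy coin `p`, the sum `a + b = 3a` leaves `3a - p`, which is at least 2 but
        -- below `a`, so it is not a coin.
        p+1≮3a p+1<3a with two-coins a∈ b∈ 0<p (top-p p≤a+b a+b<q)
          where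
          p≤a+b : p ≤ a + b
          p≤a+b = ≤-by (≤-reflexive (sym b≡2a) ⊕ p+1<3a) 2 (solve (a ◂ b ◂ p ◂ []))
          a+b<q : a + b < q
          a+b<q = ≤-by (≤-reflexive (sym q≡a+p) ⊕ b<p) 0 (solve (a ◂ b ◂ p ◂ q ◂ []))
        ... | z , p+z , inj₁ z≡0 =
          ⊥-by (≤-reflexive z≡0 ⊕ ≤-reflexive (sym p+z) ⊕ ≤-reflexive (sym b≡2a) ⊕ p+1<3a) 1
            (solve (a ◂ b ◂ p ◂ z ◂ []))
        ... | z , p+z , inj₂ z∈  =
          ⊥-by (≤-reflexive z≡1 ⊕ ≤-reflexive (sym p+z) ⊕ ≤-reflexive (sym b≡2a) ⊕ p+1<3a) 0
            (solve (a ◂ b ◂ p ◂ z ◂ []))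
          where
          z≡1 : z ≡ 1
          z≡1 = below-a z∈ (≤-by (≤-reflexive p+z ⊕ b<p) 0 (solve (a ◂ b ◂ p ◂ z ◂ [])))

        p≢3a : p ≢ a + a + a
        p≢3a p≡3a = noncanonical (exchange-pp⇒canonical b∈ 2p≡q+b (≤-reflexive (sym r≡2p)))
          where
          2p≡q+b : p + p ≡ q + b
          2p≡q+b = ≡-by (sym q≡a+p ⊞ sym b≡2a ⊞ p≡3a) (solve (a ◂ b ◂ p ◂ q ◂ []))

      case-a-1 : s ≡ a → t ≡ b → e ≡ 1 → Shape-b
      case-a-1 s≡a t≡b e≡1 = b+1≡2a , q+1≡a+p , r+1≡2p , ≮⇒≥ p+1≮3a
        where
        b+1≡2a : b + 1 ≡ a + a
        b+1≡2a = ≡-by (e+t ⊞ s≡a ⊞ s≡a ⊞ sym t≡b ⊞ sym e≡1) (solve (a ◂ b ◂ e ◂ s ◂ t ◂ []))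

        r+1≡2p : r + 1 ≡ p + p
        r+1≡2p = ≡-by (r+e ⊞ sym e≡1) (solve (e ◂ p ◂ r ◂ []))

        q+1≡a+p : q + 1 ≡ a + p
        q+1≡a+p = ≡-by (sym r+s ⊞ r+1≡2p ⊞ s≡a) (solve (a ◂ p ◂ q ◂ r ◂ s ◂ []))

        p+2≡3a : p + 1 < a + a + a → p + 2 ≡ a + a + a
        -- Below `q`, the sum `a + b` leaves `3a - 1 - p` after `p`. Otherwise `2b` leaves the same
        -- amount after `q`. It is positive and below `a`, hence 1.
        p+2≡3a p+1<3a with a + b <? q
        p+2≡3a p+1<3a | yes a+b<q with two-coins a∈ b∈ 0<p (top-p p≤a+b a+b<q)
          where
          p≤a+b : p ≤ a + b
          p≤a+b = ≤-by (≤-reflexive (sym b+1≡2a) ⊕ p+1<3a) 1 (solve (a ◂ b ◂ p ◂ []))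
        ... | z , p+z , inj₁ z≡0 =
          ⊥-by (≤-reflexive z≡0 ⊕ ≤-reflexive (sym p+z) ⊕ ≤-reflexive (sym b+1≡2a) ⊕ p+1<3a) 0
            (solve (a ◂ b ◂ p ◂ z ◂ []))
        ... | z , p+z , inj₂ z∈  = ≡-by (sym z≡1 ⊞ p+z ⊞ b+1≡2a) (solve (a ◂ b ◂ p ◂ z ◂ []))
          where
          z≡1 : z ≡ 1
          z≡1 = below-a z∈ (≤-by (≤-reflexive p+z ⊕ b<p) 0 (solve (a ◂ b ◂ p ◂ z ◂ [])))
        p+2≡3a p+1<3a | no a+b≮q with two-coins b∈ b∈ 0<q (top-q q≤2b 2b<r)
          where
          q≤2b : q ≤ b + b
          q≤2b = ≤-by (≮⇒≥ a+b≮q ⊕ a<b) 1 (solve (a ◂ b ◂ q ◂ []))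
          2b<r : b + b < r
          2b<r = ≤-by (b<p ⊕ b<p ⊕ ≤-reflexive (sym r+1≡2p)) 0 (solve (b ◂ p ◂ r ◂ []))
        ... | y , q+y , inj₁ y≡0 =
          ⊥-by (≤-reflexive y≡0 ⊕ ≤-reflexive (sym q+y) ⊕ ≮⇒≥ a+b≮q ⊕ a<b) 0
            (solve (a ◂ b ◂ q ◂ y ◂ []))
        ... | y , q+y , inj₂ y∈  =
          ≡-by (sym y≡1 ⊞ q+y ⊞ b+1≡2a ⊞ b+1≡2a ⊞ sym q+1≡a+p) (solve (a ◂ b ◂ p ◂ q ◂ y ◂ []))
          where
          y≡1 : y ≡ 1
          y≡1 =
            below-a y∈ (≤-by (≤-reflexive q+y ⊕ ≤-reflexive b+1≡2a ⊕ ≤-reflexive (sym q+1≡a+p) ⊕ b<p) 0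
              (solve (a ◂ b ◂ p ◂ q ◂ y ◂ [])))

        p+1≮3a : ¬ p + 1 < a + a + a
        -- What survives is `(1, a, 2a - 1, 3a - 2, 4a - 3, 6a - 5)`, where `2p = q + b` and
        -- `p + b = q + a`.
        p+1≮3a p+1<3a = noncanonical (exchange-pb⇒canonical b∈ 2p≡q+b a∈ p+b≡q+a p+b≤r q+a≤r
                           λ _ _ _ r≤w w<r → contradiction r≤w (<⇒≱ w<r))
          where
          eq : p + 2 ≡ a + a + a
          eq = p+2≡3a p+1<3a
          2p≡q+b : p + p ≡ q + b
          2p≡q+b = ≡-by (eq ⊞ sym b+1≡2a ⊞ sym q+1≡a+p) (solve (a ◂ b ◂ p ◂ q ◂ []))
          p+b≡q+a : p + b ≡ q + a
          p+b≡q+a = ≡-by (b+1≡2a ⊞ sym q+1≡a+p) (solve (a ◂ b ◂ p ◂ q ◂ []))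
          p+b≤r : p + b ≤ r
          p+b≤r = ≤-by (≤-reflexive (sym r+1≡2p) ⊕ b<p) 0 (solve (b ◂ p ◂ r ◂ []))
          q+a≤r : q + a ≤ r
          q+a≤r =
            ≤-by (≤-reflexive (sym r+1≡2p) ⊕ b<p ⊕ ≤-reflexive (sym b+1≡2a) ⊕ ≤-reflexive q+1≡a+p) 0
              (solve (a ◂ b ◂ p ◂ q ◂ r ◂ []))

      -- The sum `b + q` leaves `b - a + 1` after its greedy coin `r`. This is at least 2, and below
      -- `a` because `b < p = 2a - 1`, so it is no coin.
      p+1≢2a : r + a ≡ p + q → p + 1 ≢ a + a
      p+1≢2a r+a p+1≡2a with two-coins b∈ q∈ 0<r (top-r r≤b+q)
        where
        r≤b+q : r ≤ b + q
        r≤b+q = ≤-by (≤-reflexive r+a ⊕ ≤-reflexive p+1≡2a ⊕ a<b) 2 (solve (a ◂ b ◂ p ◂ q ◂ r ◂ []))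
      ... | z , r+z , inj₁ z≡0 =
        ⊥-by (≤-reflexive z≡0 ⊕ ≤-reflexive (sym r+z) ⊕ ≤-reflexive r+a ⊕ ≤-reflexive p+1≡2a ⊕ a<b) 1
          (solve (a ◂ b ◂ p ◂ q ◂ r ◂ z ◂ []))
      ... | z , r+z , inj₂ z∈  =
        ⊥-by (≤-reflexive z≡1 ⊕ ≤-reflexive (sym r+z) ⊕ ≤-reflexive r+a ⊕ ≤-reflexive p+1≡2a ⊕ a<b) 0
          (solve (a ◂ b ◂ p ◂ q ◂ r ◂ z ◂ []))
        where
        z≡1 : z ≡ 1
        z≡1 =
          below-a z∈ (≤-by (≤-reflexive r+z ⊕ ≤-reflexive (sym r+a) ⊕ b<p) 0
            (solve (a ◂ b ◂ p ◂ q ◂ r ◂ z ◂ [])))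

      case-a-p : s ≡ a → t ≡ p → e ≡ 0 ⊎ e ≡ 1 → ⊥
      case-a-p s≡a t≡p (inj₁ e≡0) = noncanonical (exchange-pp⇒canonical a∈ 2p≡q+a 2p≤r)
        where
        2p≡q+a : p + p ≡ q + a
        2p≡q+a = ≡-by (sym r+s ⊞ r+t ⊞ s≡a ⊞ sym t≡p) (solve (a ◂ p ◂ q ◂ r ◂ s ◂ t ◂ []))
        2p≤r : p + p ≤ r
        2p≤r = ≤-by (≤-reflexive (sym r+e) ⊕ ≤-reflexive e≡0) 0 (solve (e ◂ p ◂ r ◂ []))
      case-a-p s≡a t≡p (inj₂ e≡1) = p+1≢2a (subst (λ z → r + z ≡ p + q) s≡a r+s) p+1≡2a
        where
        p+1≡2a : p + 1 ≡ a + a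
        p+1≡2a = ≡-by (e+t ⊞ s≡a ⊞ s≡a ⊞ sym t≡p ⊞ sym e≡1) (solve (a ◂ e ◂ p ◂ s ◂ t ◂ []))

      -- Always `2p = q + b` here. The value of `e` decides whether this exchange suffices or is
      -- joined by `p + b = q + e`.
      case-b : s ≡ b → t ≡ p → e ≡ 0 ⊎ e ∈ (1 ∷ a ∷ []) → ⊥
      case-b s≡b t≡p = λ where
          (inj₁ e≡0)                → noncanonical (exchange-pp⇒canonical b∈ 2p≡q+b (2p≤r e≡0))
          (inj₂ (here e≡1))         → case-1′ e≡1
          (inj₂ (there (here e≡a))) → case-a′ e≡a
        where
        2p≡q+b : p + p ≡ q + b
        2p≡q+b = ≡-by (sym r+s ⊞ r+t ⊞ s≡b ⊞ sym t≡p) (solve (b ◂ p ◂ q ◂ r ◂ s ◂ t ◂ []))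

        2p≤r : e ≡ 0 → p + p ≤ r
        2p≤r e≡0 = ≤-by (≤-reflexive (sym r+e) ⊕ ≤-reflexive e≡0) 0 (solve (e ◂ p ◂ r ◂ []))

        e+p≡2b : e + p ≡ b + b
        e+p≡2b = ≡-by (e+t ⊞ s≡b ⊞ s≡b ⊞ sym t≡p) (solve (b ◂ e ◂ p ◂ s ◂ t ◂ []))

        case-1′ : e ≡ 1 → ⊥
        case-1′ e≡1 = noncanonical (exchange-pb⇒canonical b∈ 2p≡q+b 1∈ p+b≡q+1 p+b≤r q+a≤r
                        λ _ _ _ r≤w w<r → contradiction r≤w (<⇒≱ w<r))
          where
          p+b≡q+1 : p + b ≡ q + 1
          p+b≡q+1 = ≡-by (2p≡q+b ⊞ sym e+p≡2b ⊞ e≡1) (solve (b ◂ e ◂ p ◂ q ◂ []))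
          p+b≤r : p + b ≤ r
          p+b≤r =
            ≤-by (≤-reflexive (sym r+e) ⊕ ≤-reflexive e≡1 ⊕ b<p) 0 (solve (b ◂ e ◂ p ◂ r ◂ []))
          q+a≤r : q + a ≤ r
          q+a≤r =
            ≤-by (≤-reflexive (sym r+e) ⊕ ≤-reflexive e≡1 ⊕ ≤-reflexive (sym 2p≡q+b) ⊕ a<b) 0
              (solve (a ◂ b ◂ e ◂ p ◂ q ◂ r ◂ []))

        e≡a⇒p+b≡q+a : e ≡ a → p + b ≡ q + a
        e≡a⇒p+b≡q+a e≡a = ≡-by (2p≡q+b ⊞ sym e+p≡2b ⊞ e≡a) (solve (a ◂ b ◂ e ◂ p ◂ q ◂ []))

        case-a′ : e ≡ a → ⊥
        -- The threshold in `exchange-pb⇒canonical` is `r` if `q + a ≤ r`. Otherwise it is `q + a`,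
        -- which turns out to be `r + 1`, so that `r` alone needs separate treatment.
        case-a′ e≡a with r <? q + a | e≡a⇒p+b≡q+a e≡a
        ... | no r≮q+a | p+b≡q+a =
          noncanonical (exchange-pb⇒canonical b∈ 2p≡q+b a∈ p+b≡q+a
            (≤-trans (≤-reflexive p+b≡q+a) (≮⇒≥ r≮q+a)) (≮⇒≥ r≮q+a)
            λ _ _ _ r≤w w<r → contradiction r≤w (<⇒≱ w<r))
        ... | yes r<q+a | p+b≡q+a =
          noncanonical (exchange-pb⇒canonical b∈ 2p≡q+b a∈ p+b≡q+a (≤-reflexive p+b≡q+a) ≤-refl at-r)
          where
          r+1≡q+a : r + 1 ≡ q + a
          r+1≡q+a with two-coins q∈ a∈ 0<r (top-r (<⇒≤ r<q+a))
          ... | x , r+x , inj₁ x≡0 =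
            ⊥-by (≤-reflexive x≡0 ⊕ ≤-reflexive (sym r+x) ⊕ r<q+a) 0 (solve (a ◂ q ◂ r ◂ x ◂ []))
          ... | x , r+x , inj₂ x∈ =
            subst (λ z → r + z ≡ q + a) (below-a x∈ (≤-by (≤-reflexive r+x ⊕ q<r) 0
              (solve (a ◂ q ◂ r ◂ x ◂ [])))) r+x

          -- Here C₆ is (1, a, 2a - 1, 3a - 2, 4a - 3, 5a - 4).
          b+1≡2a : b + 1 ≡ a + a
          b+1≡2a = ≡-by (r+1≡q+a ⊞ sym 2p≡q+b ⊞ sym r+e ⊞ e≡a) (solve (a ◂ b ◂ e ◂ p ◂ q ◂ r ◂ []))

          p+2≡3a : p + 2 ≡ a + a + a
          p+2≡3a = ≡-by (b+1≡2a ⊞ b+1≡2a ⊞ e+p≡2b ⊞ sym e≡a) (solve (a ◂ b ◂ e ◂ p ◂ []))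

          a+p≡q+1 : a + p ≡ q + 1
          a+p≡q+1 = ≡-by (p+b≡q+a ⊞ sym b+1≡2a) (solve (a ◂ b ◂ p ◂ q ◂ []))

          b+b≡q+1 : b + b ≡ q + 1
          b+b≡q+1 = ≡-by (a+p≡q+1 ⊞ b+1≡2a ⊞ b+1≡2a ⊞ sym p+2≡3a) (solve (a ◂ b ◂ p ◂ q ◂ []))

          -- The amount is exactly `r`. First coins `a`, `b`, `p` leave `q - 1`, `p - 1`, `b - 1`,
          -- with greedy coins `p`, `b`, `a`; each resulting pair sums to `q + 1`.
          at-r : c ∈ C₅ → c ≤ p → v < q → r ≤ c + v → c + v < q + a →
                 Change C₅ v k → Spends C₅ q (c + v) (suc k)
          at-r {v = v} 1∈ _ v<q r≤ w<q+a x = ⊥-by (r≤ ⊕ v<q ⊕ q<r) 0 (solve (q ◂ r ◂ v ◂ []))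
          at-r {v = v} a∈ _ v<q r≤ w<q+a x =
            exchange 1∈ a+p≡q+1 (spend-top₅ 0<p (<-trans v<q q<r) (top-p p≤v v<q) x)
            where
            p≤v : p ≤ v
            p≤v =
              ≤-by (r≤ ⊕ ≤-reflexive (sym r+1≡q+a) ⊕ ≤-reflexive a+p≡q+1 ⊕ 1<a) 0
                (solve (a ◂ p ◂ q ◂ r ◂ v ◂ []))
          at-r {v = v} b∈ _ v<q r≤ w<q+a x =
            exchange 1∈ b+b≡q+1 (spend-top₅ 0<b (<-trans v<q q<r) (top-b b≤v v<p) x)
            where
            b≤v : b ≤ v
            b≤v =
              ≤-by (r≤ ⊕ ≤-reflexive (sym r+1≡q+a) ⊕ ≤-reflexive b+b≡q+1 ⊕ 1<a) 0
                (solve (a ◂ b ◂ q ◂ r ◂ v ◂ []))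
            v<p : v < p
            v<p = ≤-by (w<q+a ⊕ ≤-reflexive (sym p+b≡q+a)) 0 (solve (a ◂ b ◂ p ◂ q ◂ v ◂ []))
          at-r {v = v} p∈ _ v<q r≤ w<q+a x =
            exchange 1∈ (trans (+-comm p a) a+p≡q+1) (spend-top₅ 0<a (<-trans v<q q<r) (top-a a≤v v<b) x)
            where
            a≤v : a ≤ v
            a≤v =
              ≤-by (r≤ ⊕ ≤-reflexive (sym r+1≡q+a) ⊕ ≤-reflexive a+p≡q+1 ⊕ 1<a) 0
                (solve (a ◂ p ◂ q ◂ r ◂ v ◂ []))
            v<b : v < b
            v<b = ≤-by (w<q+a ⊕ ≤-reflexive (sym p+b≡q+a)) 0 (solve (a ◂ b ◂ p ◂ q ◂ v ◂ []))
          at-r q∈ q≤p = contradiction q≤p (<⇒≱ p<q)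

      s≡a⇒e≤1 : s ≡ a → e ≡ 0 ⊎ e ≡ 1
      s≡a⇒e≤1 s≡a = map₂ (λ e∈ → below-a e∈ (subst (e <_) s≡a e<s)) e-coin

      s≡b⇒e∈ : s ≡ b → e ≡ 0 ⊎ e ∈ (1 ∷ a ∷ [])
      s≡b⇒e∈ s≡b = map₂ (λ e∈ → below-b e∈ (subst (e <_) s≡b e<s)) e-coin

      classify : Shape-a ⊎ Shape-b ⊎ Shape-c
      classify with s∈
      ... | here s≡1 = inj₁ (case-1 s≡1)
      classify | there (here s≡a) with t∈ | s≡a⇒e≤1 s≡a
      ... | here t≡1                         | _        =
        ⊥-by (≤-reflexive t≡1 ⊕ s<t ⊕ 0<s) 0 (solve (s ◂ t ◂ []))
      ... | there (here t≡a)                 | _        = contradiction s<t (<-irrefl (trans s≡a (sym t≡a)))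
      ... | there (there (here t≡b))         | inj₁ e≡0 = inj₂ (inj₂ (case-a-0 s≡a t≡b e≡0))
      ... | there (there (here t≡b))         | inj₂ e≡1 = inj₂ (inj₁ (case-a-1 s≡a t≡b e≡1))
      ... | there (there (there (here t≡p))) | e≤1      = ⊥-elim (case-a-p s≡a t≡p e≤1)
      classify | there (there (here s≡b)) with t∈
      ... | here t≡1                         =
        ⊥-by (≤-reflexive t≡1 ⊕ s<t ⊕ 0<s) 0 (solve (s ◂ t ◂ []))
      ... | there (here t≡a)                 =
        ⊥-by (≤-reflexive t≡a ⊕ ≤-reflexive (sym s≡b) ⊕ s<t ⊕ a<b) 1 (solve (a ◂ b ◂ s ◂ t ◂ []))
      ... | there (there (here t≡b))         = contradiction s<t (<-irrefl (trans s≡b (sym t≡b)))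
      ... | there (there (there (here t≡p))) = ⊥-elim (case-b s≡b t≡p (s≡b⇒e∈ s≡b))

  classify : Noncanonical C₅ → Shape-a ⊎ Shape-b ⊎ Shape-c
  classify noncanonical with r <? p + q
  -- The interval from `r` to `p + q` is empty, so the criterion holds vacuously.
  ... | no r≮p+q = contradiction
          (q-spendable⇒canonical λ r≤w w<p+q → contradiction r≤w (<⇒≱ (<-≤-trans w<p+q (≮⇒≥ r≮p+q))))
          noncanonical
  ... | yes r<p+q
    with two-coins p∈ q∈ 0<r (top-r (<⇒≤ r<p+q))
       | two-coins q∈ q∈ 0<r (top-r (<⇒≤ (<-trans r<p+q (+-monoˡ-< q p<q))))
  -- The bound `r≤2p`, which makes `r` the greedy coin of `2p`, depends on `s` and `t`; hence the
  -- third sum is examined only now.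
  ... | s , r+s , s-coin | t , r+t , t-coin with two-coins p∈ p∈ 0<r (top-r r≤2p)
    where open Overlap noncanonical r<p+q r+s s-coin r+t t-coin
  ... | e , r+e , e-coin = Excess.classify r+e e-coin
    where open Overlap noncanonical r<p+q r+s s-coin r+t t-coin

  -- The greedy cost of `ℓ * b`

  ℓ : ℕ
  ℓ = ⌈ q / b ⌉

  grd-ℓb≤ℓ : grd C₆ (ℓ * b) ≤ ℓ
  grd-ℓb≤ℓ = optimal (ℓ * b)
    (subst₂ (Change C₆) (+-identityʳ (ℓ * b)) (+-identityʳ ℓ) (pay-many b∈ ℓ done))

  -- By the choice of `ℓ`, `ℓ * b = q + o` with `o < b`. Below `r` greedy takes `q` once and pays
  -- `o` with coins `a` and 1, as in `grd-two`.
  grd-ℓb : ℓ * b < r → grd C₆ (ℓ * b) ≡ (ℓ * b ∸ q + 1) ∸ ⌊ (ℓ * b ∸ q) / a ⌋ * (a ∸ 1)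
  grd-ℓb ℓb<r with m≤n⇒∃[o]m+o≡n (⌈/⌉-lower q 0<b)
  ... | o , q+o≡ℓb = begin
    grd C₆ (ℓ * b)                   ≡⟨ cong (grd C₆) q+o≡ℓb ⟨
    grd C₆ (q + o)                   ≡⟨ proj₁ (greedy-top 0<q (top-q (m≤m+n q o) q+o<r)) ⟩
    suc (grd C₆ o)                   ≡⟨ m+n∸n≡m (suc (grd C₆ o)) (f o) ⟨
    suc (grd C₆ o + f o) ∸ f o       ≡⟨ cong (λ z → suc z ∸ f o) (grd-two 0<a o<coins) ⟩
    suc o ∸ f o                      ≡⟨ cong (_∸ f o) (+-comm 1 o) ⟩
    (o + 1) ∸ f o                    ≡⟨ cong (λ z → (z + 1) ∸ f z) o≡ℓb∸q ⟩
    (ℓ * b ∸ q + 1) ∸ f (ℓ * b ∸ q)  ∎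
    where
    open ≡-Reasoning
    f : ℕ → ℕ
    f x = ⌊ x / a ⌋ * (a ∸ 1)
    o≡ℓb∸q : o ≡ ℓ * b ∸ q
    o≡ℓb∸q = trans (sym (m+n∸m≡n q o)) (cong (_∸ q) q+o≡ℓb)
    q+o<r : q + o < r
    q+o<r = subst (_< r) (sym q+o≡ℓb) ℓb<r
    o<b : o < b
    o<b = +-cancelˡ-< q o b (subst (_< q + b) (sym q+o≡ℓb) (⌈/⌉-upper q 0<b))
    o<p : o < p
    o<p = <-trans o<b b<p
    o<q : o < q
    o<q = <-trans o<p p<q
    o<coins : All (o <_) (b ∷ p ∷ q ∷ r ∷ [])
    o<coins = o<b ∷ o<p ∷ o<q ∷ <-trans o<q q<r ∷ []

  ℓb<q+b : ℓ * b < q + b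
  ℓb<q+b = ⌈/⌉-upper q 0<b

  -- In this shape `q + b = p + 3a - 2`, which is at most `r = 2p - 1` exactly when `3a ≤ p + 1`.
  ℓb<r-shape-b : Shape-b → ℓ * b < r
  ℓb<r-shape-b (b+1≡2a , q+1≡a+p , r+1≡2p , 3a≤p+1) = <-≤-trans ℓb<q+b q+b≤r
    where
    q+b≤r : q + b ≤ r
    q+b≤r =
      ≤-by (≤-reflexive b+1≡2a ⊕ ≤-reflexive q+1≡a+p ⊕ ≤-reflexive (sym r+1≡2p) ⊕ 3a≤p+1) 0
        (solve (a ◂ b ◂ p ◂ q ◂ r ◂ []))

  ℓb<r-shape-c : Shape-c → ℓ * b < r
  ℓb<r-shape-c (b≡2a , q≡a+p , r≡2p , 3a≤p+1 , _) with a + a + a ≤? p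
  -- In this shape `q + b = p + 3a`, which is at most `2p = r`.
  ... | yes 3a≤p = <-≤-trans ℓb<q+b q+b≤r
    where
    q+b≤r : q + b ≤ r
    q+b≤r =
      ≤-by (≤-reflexive b≡2a ⊕ ≤-reflexive q≡a+p ⊕ ≤-reflexive (sym r≡2p) ⊕ 3a≤p) 0
        (solve (a ◂ b ◂ p ◂ q ◂ r ◂ []))
  -- Now q = 4a - 1 and b = 2a, so ℓ = 2.
  ... | no 3a≰p = ≤-<-trans (*-monoˡ-≤ b ℓ≤2) 2b<r
    where
    q+b≤3b : q + b ≤ 3 * b
    q+b≤3b =
      ≤-by (≤-reflexive (sym b≡2a) ⊕ ≤-reflexive (sym b≡2a) ⊕ ≤-reflexive q≡a+p ⊕ ≰⇒> 3a≰p) 1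
        (solve (a ◂ b ◂ p ◂ q ◂ []))
    ℓ≤2 : ℓ ≤ 2
    ℓ≤2 = s≤s⁻¹ (*-cancelʳ-< b ℓ 3 (<-≤-trans ℓb<q+b q+b≤3b))
    2b<r : 2 * b < r
    2b<r =
      ≤-by (≤-reflexive b≡2a ⊕ ≤-reflexive b≡2a ⊕ ≤-reflexive (sym r≡2p) ⊕ 3a≤p+1 ⊕ 3a≤p+1 ⊕ 1<a ⊕ 1<a) 1
        (solve (a ◂ b ◂ p ◂ r ◂ []))

-- Translation to the form of the theorem

private
  coins≡ : ∀ {a a′ b b′ p q q′ r r′ : ℕ} → a ≡ a′ → b ≡ b′ → q ≡ q′ → r ≡ r′ →
           _≡_ {A = Vec ℕ 6} (1 ∷ a ∷ b ∷ p ∷ q ∷ r ∷ []) (1 ∷ a′ ∷ b′ ∷ p ∷ q′ ∷ r′ ∷ [])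
  coins≡ refl refl refl refl = refl

  m+1≡n⇒m≡n∸1 : ∀ {m n} → m + 1 ≡ n → m ≡ n ∸ 1
  m+1≡n⇒m≡n∸1 {m} eq = trans (sym (m+n∸n≡m m 1)) (cong (_∸ 1) eq)

  m+m≡2m : ∀ m → m + m ≡ 2 * m
  m+m≡2m m = solve (m ◂ [])

  m+m+m≡3m : ∀ m → m + m + m ≡ 3 * m
  m+m+m≡3m m = solve (m ◂ [])

theorem9 : (c₂ c₃ c₄ c₅ c₆ : ℕ) →
    let C  = 1 ∷ c₂ ∷ c₃ ∷ c₄ ∷ c₅ ∷ c₆ ∷ []
        C′ = 1 ∷ c₂ ∷ c₃ ∷ c₄ ∷ c₅ ∷ []
        ℓ  = ⌈ c₅ / c₃ ⌉
    in
    IsSystem C → Canonical C → Noncanonical C′ →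
    ( C ≡ 1 ∷ 2 ∷ 3 ∷ c₄ ∷ c₄ + 1 ∷ 2 * c₄ ∷ []
      × c₄ > 4 )
    ⊎
    ( C ≡ 1 ∷ c₂ ∷ 2 * c₂ ∸ 1 ∷ c₄ ∷ c₂ + c₄ ∸ 1 ∷ 2 * c₄ ∸ 1 ∷ []
      × c₄ ≥ 3 * c₂ ∸ 1
      × grd C (ℓ * c₃) ≡ (ℓ * c₃ ∸ c₅ + 1) ∸ ⌊ (ℓ * c₃ ∸ c₅) / c₂ ⌋ * (c₂ ∸ 1)
      × grd C (ℓ * c₃) ≤ ℓ )
    ⊎
    ( C ≡ 1 ∷ c₂ ∷ 2 * c₂ ∷ c₄ ∷ c₂ + c₄ ∷ 2 * c₄ ∷ []
      × c₄ ≥ 3 * c₂ ∸ 1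
      × c₄ ≢ 3 * c₂
      × grd C (ℓ * c₃) ≡ (ℓ * c₃ ∸ c₅ + 1) ∸ ⌊ (ℓ * c₃ ∸ c₅) / c₂ ⌋ * (c₂ ∸ 1)
      × grd C (ℓ * c₃) ≤ ℓ )
theorem9 c₂ c₃ c₄ c₅ c₆ S K N with IsSystem.increasing S
... | 1<a ∷ a<b ∷ b<p ∷ p<q ∷ q<r ∷ [-] = conclusion
  where
  open SixCoins 1<a a<b b<p p<q q<r (canonical⇒optimal S K)

  bound : c₂ + c₂ + c₂ ≤ c₄ + 1 → 3 * c₂ ∸ 1 ≤ c₄
  bound le = m≤n+o⇒m∸n≤o (3 * c₂) 1 (subst₂ _≤_ (m+m+m≡3m c₂) (+-comm c₄ 1) le)

  conclusion : _
  conclusion with classify N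
  ... | inj₁ (a≡2 , b≡3 , q≡ , r≡ , 4<p) =
    inj₁ (coins≡ a≡2 b≡3 q≡ (trans r≡ (m+m≡2m c₄)) , 4<p)
  ... | inj₂ (inj₁ shape@(b≡ , q≡ , r≡ , 3a≤p+1)) =
    inj₂ (inj₁ ( coins≡ refl (m+1≡n⇒m≡n∸1 (trans b≡ (m+m≡2m c₂)))
                   (m+1≡n⇒m≡n∸1 q≡) (m+1≡n⇒m≡n∸1 (trans r≡ (m+m≡2m c₄)))
               , bound 3a≤p+1
               , grd-ℓb (ℓb<r-shape-b shape)
               , grd-ℓb≤ℓ ))
  ... | inj₂ (inj₂ shape@(b≡ , q≡ , r≡ , 3a≤p+1 , p≢3a)) =
    inj₂ (inj₂ ( coins≡ refl (trans b≡ (m+m≡2m c₂)) q≡ (trans r≡ (m+m≡2m c₄))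
               , bound 3a≤p+1
               , (λ p≡3a → p≢3a (trans p≡3a (sym (m+m+m≡3m c₂))))
               , grd-ℓb (ℓb<r-shape-c shape)
               , grd-ℓb≤ℓ ))
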